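{- Let $(R_1,\mathcal L_1)$ and $(R_2,\mathcal L_2)$ be sets with a countable language. Suppose that Hilbert's tenth problem exists over $(R_1,\mathcal L_1)$ and over $(R_2,\mathcal L_2)$. If Hilbert's tenth problem over $(R_2,\mathcal L_2)$ has a positive answer and $d:R_1\to R_2$ is an effective Diophantine map, then Hilbert's tenth problem over $(R_1,\mathcal L_1)$ has a positive answer.
   Context: $\mathbb N=\mathbb Z_{\ge0}$. A "set with a language" $(R,\mathcal L)$ is a set $R$ together with a language $\mathcal L$ (constants, functions, relations) with an interpretation in $R$; every language contains a constant $0$ and equality. Terms are built from constants and variables using functions of $\mathcal L$; basic formulas have the form $(t_1,\ldots,t_k)\in R'$ with $R'\in\mathcal L$ a $k$-ary relation (possibly equality) and $t_i$ terms. $S\subset R^k$ is Diophantine if $S=\{\vec x\in R^k\mid\exists\vec y\in R^l\ (f_1\wedge\cdots\wedge f_r)\}$ for some basic formulas $f_i$. $d:R_1\to R_2$ is a Diophantine map if the coordinatewise image $d(S)\subset R_2^k$ is Diophantine for all $k$ and all Diophantine $S\subset R_1^k$. Existence of Hilbert's tenth problem. $S_c(\mathcal L)$ is the set of constants of $\mathcal L$ and $S_c'(\mathcal L)=\{x\in R\mid\{x\}\text{ is Diophantine}\}$. A recursive ring is a ring with a recursive representation, i.e. an injection $j$ into $\mathbb N$ with recursive image for which addition and multiplication are recursive. A recursive ring $R_0$ with $S_c(\mathcal L)\subset R_0\subset S_c'(\mathcal L)$ is compatible with $(R,\mathcal L)$ if, for the language $\mathcal L'$ on $R_0$ having each constant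 $c\in\mathcal L$, the relation $S_f\cap R_0^{r+1}$ for each $r$-ary function $f\in\mathcal L$ (with $S_f=\{(\vec x,f(\vec x))\mid\vec x\in R^r\}$) and $S\cap R_0^r$ for each $r$-ary relation $S\in\mathcal L$, one has $S_c'(\mathcal L')=R_0$ and all relations of $\mathcal L'$ are recursive in $R_0$. Hilbert's tenth problem exists over $(R,\mathcal L)$ if $\mathcal L$ is countable and a compatible recursive ring $R_0$ with $S_c(\mathcal L)\subset R_0\subset S_c'(\mathcal L)$ exists. Coding. Fix such a ring $R_i'$ with representation $j_i$ for each $(R_i,\mathcal L_i)$; the same choice is used in all notions below. Number the constants and functions of $\mathcal L_i$ injectively by $\mathrm{num}_{\mathcal L_i}$; put $\mathrm{sym}(l)=2^{\mathrm{num}_{\mathcal L_i}(l)}$ for constants and functions $l$, $\mathrm{sym}(x_n)=3^n$ for variables $x_n$, $\mathrm{sym}(r)=5^{j_i(r)}$ for $r\in R_i'$ (indices chosen so that different symbols get different codes). An $\mathcal L_i$-term (elements of $R_i'$ may occur as constants) written in bracket-free prefix form as a string $s_1\cdots s_n$ gets number $J_i(s_1\cdots s_n)=\prod_m p_m^{\mathrm{sym}(s_m)}$, $p_m$ the $m$-th prime. The relations of $\mathcal L_i$ (including equality) are numbered by natural numbers, and a finite system $(t_{11},\ldots)\in S_{i_1},\ldots,(t_{l1},\ldots)\in S_{i_l}$ is coded by the tuple $(l,i_1,J_i(t_{11}),\ldots,i_l,J_i(t_{l1}),\ldots)\in\bigcup_{n\ge0}\mathbb N^n$. Positive answer. Hilbert's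 tenth problem over $(R_i,\mathcal L_i)$ has a positive answer if there is a recursive function $f:\bigcup_{n\ge0}\mathbb N^n\to\{0,1\}$ whose value on the code of a system is $1$ if and only if the system has a solution over $R_i$. Effective. A Diophantine map $d:R_1\to R_2$ is effective if there is a recursive function $D:\bigcup_{n\ge0}\mathbb N^n\to\bigcup_{n\ge0}\mathbb N^n$ that sends the code of every system $T$ in $\mathcal L_1$ (in variables $\vec x$) to the code of a system $D(T)$ in $\mathcal L_2$ (in variables $(\vec z,\vec y)$, $\vec z$ of the same length as $\vec x$) such that: (i) if $\vec x$ is a solution of $T$ over $R_1$, there is $\vec y$ such that $(d(\vec x),\vec y)$ is a solution of $D(T)$ over $R_2$; (ii) if $(\vec z,\vec y)$ is a solution of $D(T)$ over $R_2$, there is a solution $\vec x$ of $T$ with $\vec z=d(\vec x)$. -}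

module Defs where

open import Algebra.Structures using (IsRing)
open import Data.Empty using (⊥)
import Data.Empty.Polymorphic as Poly
open import Data.Fin.Base using (Fin; toℕ)
open import Data.Fin.Patterns using (1F)
open import Data.List.Base as List using (List; []; _∷_; concatMap)
open import Data.List.Membership.Propositional using (_∈_)
open import Data.List.Relation.Unary.All using (All)
open import Data.List.Relation.Unary.Any using (Any)
open import Data.Maybe.Base using (Maybe; just; nothing)
open import Data.Nat.Base using (ℕ; zero; suc; _+_; _*_; _^_; _<_; _!)
open import Data.Nat.Primality using (prime?)
open import Data.Product.Base using (Σ; ∃; ∃-syntax; Σ-syntax; _×_; _,_; proj₁; proj₂)
open import Data.Sum.Base using (_⊎_; inj₁; inj₂)
open import Data.Vec.Base as Vec using (Vec; []; _∷_; _++_; lookup; init; last)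
import Data.Vec.Relation.Unary.Any as VecAny
open import Function.Base using (_∘_)
open import Function.Bundles using (_↣_; _⇔_; Injection)
open import Function.Definitions using (Injective)
open import Level using (Level; _⊔_) renaming (suc to lsuc)
open import Relation.Binary.PropositionalEquality using (_≡_)
open import Relation.Nullary.Decidable.Core using (yes; no)
open import Relation.Unary using (Pred)

private
  variable
    a b k p : Level
    m n : ℕ

------------------------------------------------------------------------
-- Recursive functions

-- Programs for the μ-recursive functions of n arguments, and their
-- (partial) big-step semantics: f [ xs ]↦ y says that f halts on xs with
-- value y.

data Rec : ℕ → Set where
  zero : Rec n
  succ : Rec 1
  proj : Fin n → Rec n
  comp : Rec m → Vec (Rec n) m → Rec n
  prec : Rec n → Rec (2 + n) → Rec (1 + n)
  min  : Rec (1 + n) → Rec n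

infix 4 _[_]↦_

data _[_]↦_ : Rec n → Vec ℕ n → ℕ → Set where
  zero : {xs : Vec ℕ n} → zero [ xs ]↦ 0
  succ : ∀ {x} → succ [ x ∷ [] ]↦ suc x
  proj : {i : Fin n} {xs : Vec ℕ n} → proj i [ xs ]↦ lookup xs i
  comp : {f : Rec m} {gs : Vec (Rec n) m} {xs : Vec ℕ n} {y : ℕ}
         (ys : Vec ℕ m) → (∀ i → lookup gs i [ xs ]↦ lookup ys i) →
         f [ ys ]↦ y → comp f gs [ xs ]↦ y
  prec-zero : {f : Rec n} {g : Rec (2 + n)} {xs : Vec ℕ n} {y : ℕ} →
              f [ xs ]↦ y → prec f g [ 0 ∷ xs ]↦ y
  prec-suc  : {f : Rec n} {g : Rec (2 + n)} {xs : Vec ℕ n} {x y z : ℕ} →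
              prec f g [ x ∷ xs ]↦ y → g [ x ∷ y ∷ xs ]↦ z →
              prec f g [ suc x ∷ xs ]↦ z
  min  : {f : Rec (1 + n)} {xs : Vec ℕ n} {y : ℕ} →
         f [ y ∷ xs ]↦ 0 →
         (∀ z → z < y → ∃[ w ] f [ z ∷ xs ]↦ suc w) →
         min f [ xs ]↦ y

Recursive : (Vec ℕ n → ℕ) → Set
Recursive {n} F = Σ[ f ∈ Rec n ] ∀ xs → f [ xs ]↦ F xs

RecursiveSet : Pred (Vec ℕ n) p → Set p
RecursiveSet {n} P =
  Σ[ χ ∈ (Vec ℕ n → Fin 2) ] Recursive (toℕ ∘ χ) × (∀ xs → χ xs ≡ 1F ⇔ P xs)

-- Finite tuples of arbitrary length are elements of List ℕ. Recursiveness
-- on them is transported along the bijection List ℕ → ℕ given by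
-- [] ↦ 0 and x ∷ xs ↦ 2ˣ (2 ⌜ xs ⌝ + 1).

⌜_⌝ : List ℕ → ℕ
⌜ [] ⌝     = 0
⌜ x ∷ xs ⌝ = 2 ^ x * (2 * ⌜ xs ⌝ + 1)

RecursiveOnTuples : (List ℕ → List ℕ) → Set
RecursiveOnTuples F = Σ[ f ∈ Rec 1 ] ∀ xs → f [ ⌜ xs ⌝ ∷ [] ]↦ ⌜ F xs ⌝

RecursiveOnTuples₀₁ : (List ℕ → Fin 2) → Set
RecursiveOnTuples₀₁ F = Σ[ f ∈ Rec 1 ] ∀ xs → f [ ⌜ xs ⌝ ∷ [] ]↦ toℕ (F xs)

------------------------------------------------------------------------
-- Sets with a language

-- Equality is not a member of Rel: it is adjoined in RelSym below.

record SetWithLanguage (a : Level) : Set (lsuc a) where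
  field
    R        : Set a
    Const    : Set a
    Fun      : Set a
    Rel      : Set a
    funArity : Fun → ℕ
    relArity : Rel → ℕ
    ⟦_⟧ᶜ     : Const → R
    ⟦_⟧ᶠ     : (f : Fun) → Vec R (funArity f) → R
    ⟦_⟧ʳ     : (r : Rel) → Pred (Vec R (relArity r)) a
    0ᶜ       : Const

  RelSym : Set a
  RelSym = Maybe Rel

  arity : RelSym → ℕ
  arity (just r) = relArity r
  arity nothing  = 2

  ⟦_⟧ : (r : RelSym) → Pred (Vec R (arity r)) a
  ⟦ just r  ⟧ xs           = ⟦ r ⟧ʳ xs
  ⟦ nothing ⟧ (x ∷ y ∷ []) = x ≡ y

CountableLanguage : SetWithLanguage a → Set a
CountableLanguage S = (Const ⊎ Fun ⊎ Rel) ↣ ℕ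
  where open SetWithLanguage S

-- Terms in variables V in which the elements of K occur as additional
-- constants.

module _ (S : SetWithLanguage a) where
  open SetWithLanguage S

  data Symbol (K : Set k) (V : Set) : Set (a ⊔ k) where
    con : Const → Symbol K V
    fun : Fun → Symbol K V
    elt : K → Symbol K V
    var : V → Symbol K V

  data Term (K : Set k) (V : Set) : Set (a ⊔ k) where
    con : Const → Term K V
    app : (f : Fun) → Vec (Term K V) (funArity f) → Term K V
    elt : K → Term K V
    var : V → Term K V

  record BasicFormula (K : Set k) (V : Set) : Set (a ⊔ k) where
    constructor _⟨_⟩
    field
      rel  : RelSym
      args : Vec (Term K V) (arity rel)

  System : Set k → Set → Set (a ⊔ k)
  System K V = List (BasicFormula K V)

module _ {S : SetWithLanguage a} {K : Set k} where
  open SetWithLanguage S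
  open BasicFormula

  module Semantics (κ : K → R) (x : Vec R n) where

    evalTerm  : Term S K (Fin n) → R
    evalTerms : Vec (Term S K (Fin n)) m → Vec R m

    evalTerm (con c)    = ⟦ c ⟧ᶜ
    evalTerm (app f ts) = ⟦ f ⟧ᶠ (evalTerms ts)
    evalTerm (elt r)    = κ r
    evalTerm (var i)    = lookup x i

    evalTerms []       = []
    evalTerms (t ∷ ts) = evalTerm t ∷ evalTerms ts

    Holds : BasicFormula S K (Fin n) → Set a
    Holds φ = ⟦ φ .rel ⟧ (evalTerms (φ .args))

  Solution : (K → R) → System S K (Fin n) → Pred (Vec R n) (a ⊔ k)
  Solution κ T x = All (Semantics.Holds κ x) T

  -- Bracket-free prefix notation.

  prefix  : {V : Set} → Term S K V → List (Symbol S K V)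
  prefixs : {V : Set} → Vec (Term S K V) m → List (Symbol S K V)

  prefix (con c)    = con c ∷ []
  prefix (app f ts) = fun f ∷ prefixs ts
  prefix (elt r)    = elt r ∷ []
  prefix (var v)    = var v ∷ []

  prefixs []       = []
  prefixs (t ∷ ts) = prefix t List.++ prefixs ts

  _OccursIn_ : {V : Set} → V → System S K V → Set (a ⊔ k)
  v OccursIn T = Any (λ φ → VecAny.Any (λ t → var v ∈ prefix t) (φ .args)) T

------------------------------------------------------------------------
-- Diophantine sets and maps

module _ (S : SetWithLanguage a) where
  open SetWithLanguage S

  Diophantine : Pred (Vec R n) p → Set (a ⊔ p)
  Diophantine {n} P =
    ∃[ l ] Σ[ T ∈ System S ⊥ (Fin (n + l)) ]
      ∀ x → P x ⇔ (Σ[ y ∈ Vec R l ] Solution (λ ()) T (x ++ y))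

  S′c : Pred R a
  S′c x = Diophantine {n = 1} (_≡ x ∷ [])

Image : {A : Set a} {B : Set b} → (A → B) → Pred (Vec A n) p →
        Pred (Vec B n) (a ⊔ b ⊔ p)
Image d P y = ∃[ x ] P x × Vec.map d x ≡ y

module _ (S₁ : SetWithLanguage a) (S₂ : SetWithLanguage b) where
  private
    module S₁ = SetWithLanguage S₁
    module S₂ = SetWithLanguage S₂

  DiophantineMap : (S₁.R → S₂.R) → Set (lsuc a ⊔ b)
  DiophantineMap d =
    ∀ k (P : Pred (Vec S₁.R k) a) → Diophantine S₁ P → Diophantine S₂ (Image d P)

------------------------------------------------------------------------
-- Existence of Hilbert's tenth problem

record RecursiveRing (a : Level) : Set (lsuc a) where
  field
    Carrier     : Set a
    _+ᴿ_ _*ᴿ_   : Carrier → Carrier → Carrier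
    -ᴿ_         : Carrier → Carrier
    0ᴿ 1ᴿ       : Carrier
    isRing      : IsRing _≡_ _+ᴿ_ _*ᴿ_ -ᴿ_ 0ᴿ 1ᴿ
    j           : Carrier → ℕ
    j-injective : Injective _≡_ _≡_ j
    j-image     : RecursiveSet (λ v → ∃[ x ] j x ∷ [] ≡ v)
    +-recursive : Σ[ F ∈ (Vec ℕ 2 → ℕ) ] Recursive F ×
                  (∀ x y → F (j x ∷ j y ∷ []) ≡ j (x +ᴿ y))
    *-recursive : Σ[ F ∈ (Vec ℕ 2 → ℕ) ] Recursive F ×
                  (∀ x y → F (j x ∷ j y ∷ []) ≡ j (x *ᴿ y))

  -- j has recursive image, so this does not depend on how P is treated
  -- outside the image.
  RecursiveIn : Pred (Vec Carrier n) a → Set a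
  RecursiveIn P = RecursiveSet (Image j P)

module _ (S : SetWithLanguage a) where
  open SetWithLanguage S

  -- The language ℒ′ on the subset R₀ of R included by ι, given the
  -- constants as elements of R₀. It has no functions: an r-ary function f
  -- becomes the (r + 1)-ary relation "the last entry is f of the others".
  restrict : (R₀ : Set a) → (R₀ → R) → (Const → R₀) → SetWithLanguage a
  restrict R₀ ι c₀ = record
    { R        = R₀
    ; Const    = Const
    ; Fun      = Poly.⊥
    ; Rel      = Fun ⊎ Rel
    ; funArity = λ ()
    ; relArity = relArity′
    ; ⟦_⟧ᶜ     = c₀
    ; ⟦_⟧ᶠ     = λ ()
    ; ⟦_⟧ʳ     = ⟦_⟧′
    ; 0ᶜ       = 0ᶜ
    }
    where
    relArity′ : Fun ⊎ Rel → ℕ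
    relArity′ (inj₁ f) = suc (funArity f)
    relArity′ (inj₂ r) = relArity r

    ⟦_⟧′ : (r : Fun ⊎ Rel) → Pred (Vec R₀ (relArity′ r)) a
    ⟦ inj₁ f ⟧′ x = ⟦ f ⟧ᶠ (Vec.map ι (init x)) ≡ ι (last x)
    ⟦ inj₂ r ⟧′ x = ⟦ r ⟧ʳ (Vec.map ι x)

-- R₀ is a subset of R by means of the injection ι. No relation is assumed
-- between the ring operations of R₀ and the language.

record CompatibleRing (S : SetWithLanguage a) : Set (lsuc a) where
  open SetWithLanguage S
  field
    recursiveRing : RecursiveRing a
  open RecursiveRing recursiveRing public
    renaming (Carrier to R₀)
  field
    ι           : R₀ → R
    ι-injective : Injective _≡_ _≡_ ι
    Sc⊆R₀       : ∀ c → ∃[ r ] ι r ≡ ⟦ c ⟧ᶜ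
    R₀⊆S′c      : ∀ r → S′c S (ι r)

  S′ : SetWithLanguage a
  S′ = restrict S R₀ ι (λ c → proj₁ (Sc⊆R₀ c))

  field
    R₀⊆S′c[ℒ′]          : ∀ r → S′c S′ r
    relations-recursive : (r : SetWithLanguage.RelSym S′) →
                          RecursiveIn (SetWithLanguage.⟦_⟧ S′ r)

record H10Exists (S : SetWithLanguage a) : Set (lsuc a) where
  field
    countable  : CountableLanguage S
    compatible : CompatibleRing S

------------------------------------------------------------------------
-- Coding of systems

-- The least prime in {q , … , q + s}, or q + s + 1 if there is none. By
-- Euclid, {q + 1 , … , q ! + 1} contains a prime for q ≥ 1, so nextPrime q
-- is the least prime above q.

searchPrime : ℕ → ℕ → ℕ
searchPrime q s with prime? q
searchPrime q s       | yes _ = q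
searchPrime q zero    | no _  = suc q
searchPrime q (suc s) | no _  = searchPrime (suc q) s

nextPrime : ℕ → ℕ
nextPrime q = searchPrime (suc q) (q !)

-- primePowers q (c₁ ∷ c₂ ∷ …) = q ^ c₁ * q′ ^ c₂ * …, with q′ , … the
-- primes following q.

primePowers : ℕ → List ℕ → ℕ
primePowers q []       = 1
primePowers q (c ∷ cs) = q ^ c * primePowers (nextPrime q) cs

-- The variables are x₁ , x₂ , …; the natural number v stands for x_{v+1}.

module _ {S : SetWithLanguage a} {K : Set k} where
  open SetWithLanguage S

  symbolCode : (K → ℕ) → (Const ⊎ Fun) ↣ ℕ → Symbol S K ℕ → ℕ
  symbolCode j num (con c) = 2 ^ Injection.to num (inj₁ c)
  symbolCode j num (fun f) = 2 ^ Injection.to num (inj₂ f)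
  symbolCode j num (var v) = 3 ^ suc v
  symbolCode j num (elt r) = 5 ^ j r

  rename : {V : Set} → (V → ℕ) → Symbol S K V → Symbol S K ℕ
  rename ν (con c) = con c
  rename ν (fun f) = fun f
  rename ν (elt r) = elt r
  rename ν (var v) = var (ν v)

record Coding {S : SetWithLanguage a} (H : H10Exists S) : Set a where
  open SetWithLanguage S
  open H10Exists H
  open CompatibleRing compatible

  field
    num    : (Const ⊎ Fun) ↣ ℕ
    relNum : RelSym ↣ ℕ

  sym : Symbol S R₀ ℕ → ℕ
  sym = symbolCode j num

  field
    sym-injective : Injective _≡_ _≡_ sym

  J : {V : Set} → (V → ℕ) → Term S R₀ V → ℕ
  J ν t = primePowers 2 (List.map (sym ∘ rename ν) (prefix t))

  -- ν names the variables v : V of the formulas.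
  codeFormula : {V : Set} → (V ↣ ℕ) → BasicFormula S R₀ V → List ℕ
  codeFormula ν (r ⟨ ts ⟩) =
    Injection.to relNum r ∷ Vec.toList (Vec.map (J (Injection.to ν)) ts)

  code : {V : Set} → (V ↣ ℕ) → System S R₀ V → List ℕ
  code ν T = List.length T ∷ concatMap (codeFormula ν) T

  PositiveAnswer : Set a
  PositiveAnswer =
    Σ[ f ∈ (List ℕ → Fin 2) ] RecursiveOnTuples₀₁ f ×
      (∀ n (ν : Fin n ↣ ℕ) (T : System S R₀ (Fin n)) →
         f (code ν T) ≡ 1F ⇔ ∃ (Solution ι T))

------------------------------------------------------------------------
-- Effective maps

-- The variables x of T are exactly the variables occurring in T: a code
-- does not record any others. The variables of D(T), on the other hand,
-- are only required to lie among (z , y), whose names ν′ may be chosen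
-- freely.

module _ {S₁ : SetWithLanguage a} {S₂ : SetWithLanguage b}
         {H₁ : H10Exists S₁} {H₂ : H10Exists S₂}
         (C₁ : Coding H₁) (C₂ : Coding H₂) where
  private
    module S₁ = SetWithLanguage S₁
    module S₂ = SetWithLanguage S₂
    module R₁ = CompatibleRing (H10Exists.compatible H₁)
    module R₂ = CompatibleRing (H10Exists.compatible H₂)
    module C₁ = Coding C₁
    module C₂ = Coding C₂

  Effective : (S₁.R → S₂.R) → Set (a ⊔ b)
  Effective d =
    Σ[ D ∈ (List ℕ → List ℕ) ] RecursiveOnTuples D ×
      (∀ n (ν : Fin n ↣ ℕ) (T : System S₁ R₁.R₀ (Fin n)) →
         (∀ i → i OccursIn T) →
         ∃[ m ] Σ[ ν′ ∈ Fin (n + m) ↣ ℕ ] Σ[ U ∈ System S₂ R₂.R₀ (Fin (n + m)) ]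
           (D (C₁.code ν T) ≡ C₂.code ν′ U) ×
           (∀ x → Solution R₁.ι T x →
              Σ[ y ∈ Vec S₂.R m ] Solution R₂.ι U (Vec.map d x ++ y)) ×
           (∀ z (y : Vec S₂.R m) → Solution R₂.ι U (z ++ y) →
              ∃[ x ] Solution R₁.ι T x × z ≡ Vec.map d x))

{-# OPTIONS --safe #-}
module Submission where

-- Let f₂ decide systems over R₂ and let D be the recursive translation of
-- codes that comes with d. Properties (i) and (ii) of D say in particular
-- that T is solvable over R₁ if and only if D(T) is solvable over R₂, so
-- f₂ ∘ D decides systems over R₁, and it is recursive as a composition.
--
-- The one point that needs an argument is that D is only controlled on
-- systems in exactly the variables that occur in them, while a positive
-- answer concerns systems in any finite list of variables. A variable that
-- does not occur in T can be dropped (removeVariable): T is then a renaming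
-- of a system in the other variables (mapSystem-surjective), the code of T
-- does not mention the dropped one (code-map), and a solution of the smaller
-- system extends to one of T by giving it the value of the constant 0
-- (solution-map). Dropping all such variables (removeUnused) leaves a system
-- with the same code and the same solvability, to which D applies.

open import Level using (Level)
open import Defs

open import Data.Fin.Base using (Fin; zero; punchIn; punchOut)
open import Data.Fin.Patterns using (1F)
open import Data.Fin.Properties
  using (all?; ¬∀⟶∃¬; punchIn-injective; punchIn-punchOut)
  renaming (_≟_ to _≟ᶠ_)
open import Data.List.Base as List using (List; []; _∷_)
open import Data.List.Membership.Propositional using (_∈_)
open import Data.List.Membership.Propositional.Properties using (∈-++⁺ˡ; ∈-++⁺ʳ)
open import Data.List.Properties
  using (map-++; map-∘; length-map; concatMap-map; concatMap-cong)
import Data.List.Relation.Unary.All as All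
import Data.List.Relation.Unary.All.Properties as Allₚ
open import Data.List.Relation.Unary.Any using (here; there; any?)
open import Data.Nat.Base using (ℕ; zero; suc; _+_)
open import Data.Product.Base using (∃; ∃-syntax; Σ-syntax; _×_; _,_; proj₁; proj₂)
open import Data.Vec.Base as Vec using (Vec; []; _∷_; insertAt; lookup; splitAt; tabulate)
open import Data.Vec.Properties using (lookup∘tabulate; insertAt-punchIn)
import Data.Vec.Relation.Unary.Any as VecAny
open import Function.Base using (_∘_)
open import Function.Bundles using (_↣_; _⇔_; Injection; Equivalence; mk↣; mk⇔)
open import Function.Construct.Composition using (_↣-∘_; _⇔-∘_)
open import Relation.Binary.PropositionalEquality
  using (_≡_; refl; sym; trans; cong; cong₂; subst)
open import Relation.Nullary using (¬_; Dec; yes; no; contradiction)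

------------------------------------------------------------------------
-- Renaming the variables of terms and systems

module _ {a k : Level} {S : SetWithLanguage a} {K : Set k} where
  open SetWithLanguage S

  ∈-prefixs : {V : Set} {v : V} {m : ℕ} (ts : Vec (Term S K V) m) →
    VecAny.Any (λ t → var v ∈ prefix t) ts → var v ∈ prefixs ts
  ∈-prefixs (t ∷ ts) (VecAny.here v∈t)   = ∈-++⁺ˡ v∈t
  ∈-prefixs (t ∷ ts) (VecAny.there v∈ts) = ∈-++⁺ʳ (prefix t) (∈-prefixs ts v∈ts)

  module _ {V W : Set} (ρ : W → V) where

    -- The renaming w ↦ ρ w of variables, on terms, formulas and systems.

    mapTerm  : Term S K W → Term S K V
    mapTerms : ∀ {m} → Vec (Term S K W) m → Vec (Term S K V) m

    mapTerm (con c)    = con c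
    mapTerm (app f ts) = app f (mapTerms ts)
    mapTerm (elt r)    = elt r
    mapTerm (var w)    = var (ρ w)

    mapTerms []       = []
    mapTerms (t ∷ ts) = mapTerm t ∷ mapTerms ts

    mapFormula : BasicFormula S K W → BasicFormula S K V
    mapFormula (r ⟨ ts ⟩) = r ⟨ mapTerms ts ⟩

    mapSystem : System S K W → System S K V
    mapSystem = List.map mapFormula

    -- Here ν names the variables, as in the coding of terms.
    rename-prefix : (ν : V → ℕ) (t : Term S K W) →
      List.map (rename ν) (prefix (mapTerm t)) ≡ List.map (rename (ν ∘ ρ)) (prefix t)
    rename-prefixs : ∀ {m} (ν : V → ℕ) (ts : Vec (Term S K W) m) →
      List.map (rename ν) (prefixs (mapTerms ts)) ≡ List.map (rename (ν ∘ ρ)) (prefixs ts)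

    rename-prefix ν (con c)    = refl
    rename-prefix ν (app f ts) = cong (fun f ∷_) (rename-prefixs ν ts)
    rename-prefix ν (elt r)    = refl
    rename-prefix ν (var w)    = refl

    rename-prefixs ν []       = refl
    rename-prefixs ν (t ∷ ts) =
      trans (map-++ (rename ν) (prefix (mapTerm t)) (prefixs (mapTerms ts)))
        (trans (cong₂ List._++_ (rename-prefix ν t) (rename-prefixs ν ts))
               (sym (map-++ (rename (ν ∘ ρ)) (prefix t) (prefixs ts))))

    -- If all the variables of an expression lie in the image of ρ, then the
    -- expression is a renaming along ρ.

    mapTerm-surjective : (t : Term S K V) →
      (∀ v → var v ∈ prefix t → ∃[ w ] ρ w ≡ v) → ∃[ t′ ] mapTerm t′ ≡ t
    mapTerms-surjective : ∀ {m} (ts : Vec (Term S K V) m) →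
      (∀ v → VecAny.Any (λ t → var v ∈ prefix t) ts → ∃[ w ] ρ w ≡ v) →
      ∃[ ts′ ] mapTerms ts′ ≡ ts

    mapTerm-surjective (con c)    _  = con c , refl
    mapTerm-surjective (app f ts) im =
      let ts′ , eq = mapTerms-surjective ts (λ v → im v ∘ there ∘ ∈-prefixs ts)
      in app f ts′ , cong (app f) eq
    mapTerm-surjective (elt r)    _  = elt r , refl
    mapTerm-surjective (var v)    im =
      let w , eq = im v (here refl) in var w , cong var eq

    mapTerms-surjective []       _  = [] , refl
    mapTerms-surjective (t ∷ ts) im =
      let t′  , eq  = mapTerm-surjective t (λ v → im v ∘ VecAny.here)
          ts′ , eqs = mapTerms-surjective ts (λ v → im v ∘ VecAny.there)
      in t′ ∷ ts′ , cong₂ _∷_ eq eqs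

    mapSystem-surjective : (T : System S K V) →
      (∀ v → v OccursIn T → ∃[ w ] ρ w ≡ v) → ∃[ T′ ] mapSystem T′ ≡ T
    mapSystem-surjective []              _  = [] , refl
    mapSystem-surjective ((r ⟨ ts ⟩) ∷ T) im =
      let ts′ , eq  = mapTerms-surjective ts (λ v → im v ∘ here)
          T′  , eqs = mapSystem-surjective T (λ v → im v ∘ there)
      in (r ⟨ ts′ ⟩) ∷ T′ , cong₂ _∷_ (cong (r ⟨_⟩) eq) eqs

  -- The values of the variables are transported along ρ.
  module _ {m n : ℕ} (ρ : Fin m → Fin n) (κ : K → R)
           (x : Vec R n) (x′ : Vec R m)
           (x∘ρ≡x′ : ∀ i → lookup x (ρ i) ≡ lookup x′ i) where
    private
      module X  = Semantics {S = S} κ x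
      module X′ = Semantics {S = S} κ x′

    evalTerm-map : (t : Term S K (Fin m)) →
      X.evalTerm (mapTerm ρ t) ≡ X′.evalTerm t
    evalTerms-map : ∀ {l} (ts : Vec (Term S K (Fin m)) l) →
      X.evalTerms (mapTerms ρ ts) ≡ X′.evalTerms ts

    evalTerm-map (con c)    = refl
    evalTerm-map (app f ts) = cong ⟦ f ⟧ᶠ (evalTerms-map ts)
    evalTerm-map (elt r)    = refl
    evalTerm-map (var i)    = x∘ρ≡x′ i

    evalTerms-map []       = refl
    evalTerms-map (t ∷ ts) = cong₂ _∷_ (evalTerm-map t) (evalTerms-map ts)

    solution-map : (T : System S K (Fin m)) →
      Solution κ (mapSystem ρ T) x ⇔ Solution κ T x′
    solution-map T = mk⇔
      (λ sol → All.map (λ {φ} → to φ) (Allₚ.map⁻ sol))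
      (λ sol → Allₚ.map⁺ (All.map (λ {φ} → from φ) sol))
      where
      to : ∀ φ → X.Holds (mapFormula ρ φ) → X′.Holds φ
      to (r ⟨ ts ⟩) = subst ⟦ r ⟧ (evalTerms-map ts)

      from : ∀ φ → X′.Holds φ → X.Holds (mapFormula ρ φ)
      from (r ⟨ ts ⟩) = subst ⟦ r ⟧ (sym (evalTerms-map ts))

  _occursIn?_ : ∀ {n} (i : Fin n) (T : System S K (Fin n)) → Dec (i OccursIn T)
  i occursIn? T =
    any? (λ φ → VecAny.any? (λ t → any? var-i? (prefix t)) (BasicFormula.args φ)) T
    where
    var-i? : ∀ s → Dec (var i ≡ s)
    var-i? (con c) = no λ ()
    var-i? (fun f) = no λ ()
    var-i? (elt r) = no λ ()
    var-i? (var j) with i ≟ᶠ j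
    ... | yes i≡j = yes (cong var i≡j)
    ... | no  i≢j = no λ { refl → i≢j refl }

------------------------------------------------------------------------
-- Dropping the variables that do not occur

module _ {a : Level} {S : SetWithLanguage a} {H : H10Exists S} (C : Coding H) where
  open SetWithLanguage S
  open CompatibleRing (H10Exists.compatible H) using (R₀; ι)
  private module C = Coding C

  -- The code of a renamed system, when the names of its variables are
  -- changed accordingly.
  code-map : {V W : Set} (ν : V ↣ ℕ) (ρ : W ↣ V) (T : System S R₀ W) →
    C.code ν (mapSystem (Injection.to ρ) T) ≡ C.code (ν ↣-∘ ρ) T
  code-map {W = W} ν ρ T = cong₂ _∷_ (length-map (mapFormula ρ.to) T)
    (trans (concatMap-map (C.codeFormula ν) (mapFormula ρ.to) T)
           (concatMap-cong codeFormula-map T))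
    where
    module ν = Injection ν
    module ρ = Injection ρ

    J-map : ∀ t → C.J ν.to (mapTerm ρ.to t) ≡ C.J (ν.to ∘ ρ.to) t
    J-map t = cong (primePowers 2)
      (trans (map-∘ (prefix (mapTerm ρ.to t)))
        (trans (cong (List.map C.sym) (rename-prefix ρ.to ν.to t))
               (sym (map-∘ (prefix t)))))

    Js-map : ∀ {m} (ts : Vec (Term S R₀ W) m) →
      Vec.toList (Vec.map (C.J ν.to) (mapTerms ρ.to ts)) ≡
      Vec.toList (Vec.map (C.J (ν.to ∘ ρ.to)) ts)
    Js-map []       = refl
    Js-map (t ∷ ts) = cong₂ _∷_ (J-map t) (Js-map ts)

    codeFormula-map : ∀ φ →
      C.codeFormula ν (mapFormula ρ.to φ) ≡ C.codeFormula (ν ↣-∘ ρ) φ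
    codeFormula-map (r ⟨ ts ⟩) = cong (Injection.to C.relNum r ∷_) (Js-map ts)

  -- Systems, with names for their possibly different variables, that have the
  -- same code and of which one is solvable if and only if the other is.
  record _~_ {m n : ℕ} (T : Σ[ _ ∈ Fin m ↣ ℕ ] System S R₀ (Fin m))
                       (T′ : Σ[ _ ∈ Fin n ↣ ℕ ] System S R₀ (Fin n)) : Set a where
    field
      code≡    : C.code (proj₁ T) (proj₂ T) ≡ C.code (proj₁ T′) (proj₂ T′)
      solvable : ∃ (Solution ι (proj₂ T)) ⇔ ∃ (Solution ι (proj₂ T′))

  open _~_ public

  removeVariable : ∀ {n} (ν : Fin (suc n) ↣ ℕ) (T : System S R₀ (Fin (suc n))) i →
    ¬ i OccursIn T → Σ[ ν′ ∈ Fin n ↣ ℕ ] ∃[ T′ ] (ν , T) ~ (ν′ , T′)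
  removeVariable {n} ν T i i∉T with mapSystem-surjective (punchIn i) T inImage
    where
    inImage : ∀ j → j OccursIn T → ∃[ k ] punchIn i k ≡ j
    inImage j j∈T = punchOut i≢j , punchIn-punchOut i≢j
      where
      i≢j : ¬ i ≡ j
      i≢j refl = i∉T j∈T
  ... | T′ , refl = ν ↣-∘ skip , T′ , record
    { code≡    = code-map ν skip T′
    ; solvable = mk⇔
        (λ (x , sol) →
          let x′ = tabulate (lookup x ∘ punchIn i)
          in x′ , Equivalence.to
               (solution-map (punchIn i) ι x x′
                  (λ j → sym (lookup∘tabulate (lookup x ∘ punchIn i) j)) T′) sol)
        (λ (x′ , sol) →
          let x = insertAt x′ i ⟦ 0ᶜ ⟧ᶜ
          in x , Equivalence.from
               (solution-map (punchIn i) ι x x′ (insertAt-punchIn x′ i ⟦ 0ᶜ ⟧ᶜ) T′) sol)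
    }
    where
    skip : Fin n ↣ Fin (suc n)
    skip = mk↣ (λ {j} {k} → punchIn-injective i j k)

  removeUnused : ∀ n (ν : Fin n ↣ ℕ) (T : System S R₀ (Fin n)) →
    ∃[ m ] Σ[ ν′ ∈ Fin m ↣ ℕ ] ∃[ T′ ] (∀ i → i OccursIn T′) × (ν , T) ~ (ν′ , T′)
  removeUnused n ν T with all? (_occursIn? T)
  removeUnused n ν T | yes all =
    n , ν , T , all , record { code≡ = refl ; solvable = mk⇔ (λ s → s) (λ s → s) }
  removeUnused zero ν T | no ¬all = contradiction (λ ()) ¬all
  removeUnused (suc n) ν T | no ¬all =
    let i , i∉T                  = ¬∀⟶∃¬ (suc n) (_OccursIn T) (_occursIn? T) ¬all
        ν₁ , T₁ , T~T₁           = removeVariable ν T i i∉T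
        m , ν₂ , T₂ , all , T₁~T₂ = removeUnused n ν₁ T₁
    in m , ν₂ , T₂ , all , record
         { code≡    = trans (code≡ T~T₁) (code≡ T₁~T₂)
         ; solvable = solvable T₁~T₂ ⇔-∘ solvable T~T₁
         }

------------------------------------------------------------------------
-- Composing the translation with the decision procedure

recursive-∘ : {f : List ℕ → Fin 2} {D : List ℕ → List ℕ} →
  RecursiveOnTuples₀₁ f → RecursiveOnTuples D → RecursiveOnTuples₀₁ (f ∘ D)
recursive-∘ {D = D} (f , f↦) (g , g↦) = comp f (g ∷ []) , λ xs →
  comp (⌜ D xs ⌝ ∷ []) (λ { zero → g↦ xs }) (f↦ (D xs))

theorem1p9 : ∀ {a b : Level} (S₁ : SetWithLanguage a) (S₂ : SetWithLanguage b) →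
    CountableLanguage S₁ → CountableLanguage S₂ →
    (H₁ : H10Exists S₁) (H₂ : H10Exists S₂) (C₁ : Coding H₁) (C₂ : Coding H₂) →
    Coding.PositiveAnswer C₂ →
    (d : SetWithLanguage.R S₁ → SetWithLanguage.R S₂) →
    DiophantineMap S₁ S₂ d → Effective C₁ C₂ d →
    Coding.PositiveAnswer C₁
theorem1p9 S₁ S₂ _ _ H₁ H₂ C₁ C₂ (f₂ , f₂-rec , f₂-decides) d _ (D , D-rec , D-translates) =
  f₂ ∘ D , recursive-∘ f₂-rec D-rec , decides
  where
  open CompatibleRing (H10Exists.compatible H₁) using (R₀; ι)

  decides : ∀ n (ν : Fin n ↣ ℕ) (T : System S₁ R₀ (Fin n)) →
    f₂ (D (Coding.code C₁ ν T)) ≡ 1F ⇔ ∃ (Solution ι T)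
  decides n ν T with removeUnused C₁ n ν T
  ... | n′ , ν₁ , T₁ , all , T~T₁ with D-translates n′ ν₁ T₁ all
  ... | m , ν₂ , U , D≡ , forth , back =
    subst (λ c → f₂ c ≡ 1F ⇔ ∃ (Solution ι T)) (sym (trans (cong D (code≡ T~T₁)) D≡))
      (mk⇔ (Equivalence.from (solvable T~T₁) ∘ U⇒T₁) (T₁⇒U ∘ Equivalence.to (solvable T~T₁))
        ⇔-∘ f₂-decides (n′ + m) ν₂ U)
    where
    U⇒T₁ : ∃ (Solution _ U) → ∃ (Solution ι T₁)
    U⇒T₁ (zy , sol) with splitAt n′ zy
    ... | z , y , refl = let x , sol₁ , _ = back z y sol in x , sol₁

    T₁⇒U : ∃ (Solution ι T₁) → ∃ (Solution _ U)
    T₁⇒U (x , sol₁) = let y , sol = forth x sol₁ in Vec.map d x Vec.++ y , sol
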